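{- Let $(X,0)$ be a pointed CFG-space over a Boolean algebra $B$, and let $U_1,U_2\subset X$ be subsets which are CFG-spaces with the restricted metric and satisfy $0\in U_1\cap U_2$. If $U_1$ is isometric to $U_2$, then $U_1^\perp$ is isometric to $U_2^\perp$.
   Context: A Boolean metric space over $B$ is a set $X$ with symmetric $d:X\times X\to B$, $d(x,y)=0$ iff $x=y$, and $d(x,z)\le d(x,y)\vee d(y,z)$. An isometry is a bijection preserving $d$. A partition of $B$ is a finite family of pairwise disjoint elements with supremum $1$; $x$ is a convex combination of $x_0,\dots,x_n$ with coefficients a partition $a_0,\dots,a_n$ if $a_i\wedge d(x,x_i)=0$ for all $i$. A CFG-space is a Boolean metric space that is convex (every such convex combination of its points exists in it) and finitely generated (some finite subset $S$ has every point as a convex combination of points of $S$). A pointed space is a pair $(X,0)$ with $0\in X$ a fixed point; write $|x|=d(x,0)$. Elements $x,y$ are orthogonal, $x\perp y$, if $d(x,y)=|x|\vee|y|$. For $U\subset X$ with $0\in U$, $U^\perp=\{y\in X: x\perp y\ \forall x\in U\}$ (with the restricted metric). -}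

module Defs where

open import Level using (Level; _⊔_) renaming (suc to lsuc)
open import Algebra.Lattice.Bundles using (BooleanAlgebra)
import Algebra.Lattice.Properties.BooleanAlgebra as BooleanAlgebraProperties
open import Data.Nat.Base using (ℕ; suc)
open import Data.Fin.Base using (Fin)
open import Data.List.Base using (List)
import Data.List.Membership.Setoid as ListMembership
open import Data.Product.Base using (Σ-syntax; ∃-syntax; _×_; _,_; proj₁)
open import Data.Vec.Functional using (Vector; foldr)
open import Function.Bundles using (Bijection; _⇔_; Equivalence)
open import Relation.Binary.Bundles using (Setoid; Poset)
open import Relation.Binary.Definitions using (_Respects_)
import Relation.Binary.Construct.On as On
open import Relation.Binary.PropositionalEquality.Core using (_≢_)
open import Relation.Unary using (Pred)

module _ {b ℓ : Level} (B : BooleanAlgebra b ℓ) where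
  open BooleanAlgebra B using (_≈_; _∨_; _∧_; ⊤; ⊥) renaming (Carrier to ∣B∣)
  open Poset (BooleanAlgebraProperties.poset B) using (_≤_)

  -- Equality of points is a setoid equality.  That d respects it is not assumed,
  -- as it follows from the axioms (see d-cong).
  record BooleanMetricSpace (x ℓx : Level) : Set (b ⊔ ℓ ⊔ lsuc (x ⊔ ℓx)) where
    field
      setoid : Setoid x ℓx

    open Setoid setoid public
      using (Carrier) renaming (_≈_ to _≈ₚ_)

    field
      d        : Carrier → Carrier → ∣B∣
      d-sym    : ∀ p q → d p q ≈ d q p
      d-zero   : ∀ p q → (d p q ≈ ⊥) ⇔ (p ≈ₚ q)
      triangle : ∀ p q r → d p r ≤ (d p q ∨ d q r)

  -- The pieces of a partition are allowed to be ⊥.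
  record IsPartition {n : ℕ} (a : Vector ∣B∣ n) : Set ℓ where
    field
      disjoint : ∀ i j → i ≢ j → (a i ∧ a j) ≈ ⊥
      covering : foldr _∨_ ⊥ a ≈ ⊤

module _ {b ℓ x ℓx : Level} {B : BooleanAlgebra b ℓ} (X : BooleanMetricSpace B x ℓx) where
  open BooleanAlgebra B using (_≈_; _∧_; ⊥) renaming (Carrier to ∣B∣)
  open BooleanMetricSpace X

  record IsConvexCombination {n : ℕ} (a : Vector ∣B∣ n) (xs : Vector Carrier n)
                             (p : Carrier) : Set ℓ where
    field
      isPartition : IsPartition B a
      agrees      : ∀ i → (a i ∧ d p (xs i)) ≈ ⊥

  IsConvex : Set (b ⊔ ℓ ⊔ x)
  IsConvex = ∀ {n} (a : Vector ∣B∣ (suc n)) (xs : Vector Carrier (suc n)) →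
             IsPartition B a → ∃[ p ] IsConvexCombination a xs p

  -- The finite subset is given by a list of its elements.
  IsFinitelyGenerated : Set (b ⊔ ℓ ⊔ x ⊔ ℓx)
  IsFinitelyGenerated =
    Σ[ S ∈ List Carrier ] ∀ p →
      ∃[ n ] Σ[ a ∈ Vector ∣B∣ (suc n) ] Σ[ xs ∈ Vector Carrier (suc n) ]
        (∀ i → xs i ∈ S) × IsConvexCombination a xs p
    where open ListMembership setoid using (_∈_)

  record IsCFG : Set (b ⊔ ℓ ⊔ x ⊔ ℓx) where
    field
      convex            : IsConvex
      finitelyGenerated : IsFinitelyGenerated

  record Subset (u : Level) : Set (x ⊔ ℓx ⊔ lsuc u) where
    field
      member   : Pred Carrier u
      respects : member Respects _≈ₚ_

  subspace : {u : Level} → Subset u → BooleanMetricSpace B (x ⊔ u) ℓx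
  subspace U = record
    { setoid   = On.setoid setoid (proj₁ {B = Subset.member U})
    ; d        = λ (p , _) (q , _) → d p q
    ; d-sym    = λ (p , _) (q , _) → d-sym p q
    ; d-zero   = λ (p , _) (q , _) → d-zero p q
    ; triangle = λ (p , _) (q , _) (r , _) → triangle p q r
    }

  d-cong : ∀ {p p′ q q′} → p ≈ₚ p′ → q ≈ₚ q′ → d p q ≈ d p′ q′
  d-cong {p} {p′} {q} {q′} p≈p′ q≈q′ = trans (d-congʳ p≈p′) (trans (d-sym _ _)
    (trans (d-congʳ q≈q′) (d-sym _ _)))
    where
    open BooleanAlgebra B using (trans; ∨-congʳ)
    open BooleanAlgebraProperties B using (∨-identityˡ; poset)
    open Poset poset using (_≤_; ≤-respʳ-≈; antisym)

    d-mono : ∀ {r s t} → r ≈ₚ s → d r t ≤ d s t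
    d-mono {r} {s} {t} r≈s = ≤-respʳ-≈
      (trans (∨-congʳ (Equivalence.from (d-zero r s) r≈s)) (∨-identityˡ _))
      (triangle r s t)

    d-congʳ : ∀ {r s t} → r ≈ₚ s → d r t ≈ d s t
    d-congʳ r≈s = antisym (d-mono r≈s) (d-mono (Setoid.sym setoid r≈s))

record Isometry {b ℓ x ℓx y ℓy : Level} {B : BooleanAlgebra b ℓ}
                (X : BooleanMetricSpace B x ℓx) (Y : BooleanMetricSpace B y ℓy)
                : Set (ℓ ⊔ x ⊔ ℓx ⊔ y ⊔ ℓy) where
  private
    module X = BooleanMetricSpace X
    module Y = BooleanMetricSpace Y
  open BooleanAlgebra B using (_≈_)

  field
    bijection : Bijection X.setoid Y.setoid

  open Bijection bijection public using (to)

  field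
    preserves-d : ∀ p q → Y.d (to p) (to q) ≈ X.d p q

record PointedSpace {b ℓ : Level} (B : BooleanAlgebra b ℓ) (x ℓx : Level)
                    : Set (b ⊔ ℓ ⊔ lsuc (x ⊔ ℓx)) where
  field
    space : BooleanMetricSpace B x ℓx

  open BooleanMetricSpace space public

  field
    0ₚ : Carrier

module _ {b ℓ x ℓx : Level} {B : BooleanAlgebra b ℓ} (X : PointedSpace B x ℓx) where
  open BooleanAlgebra B using (_≈_; _∨_; trans; refl; ∨-cong) renaming (Carrier to ∣B∣)
  open PointedSpace X

  norm : Carrier → ∣B∣
  norm p = d p 0ₚ

  Orthogonal : Carrier → Carrier → Set ℓ
  Orthogonal p q = d p q ≈ (norm p ∨ norm q)

  orthogonalComplement : {u : Level} → Subset space u → Subset space (ℓ ⊔ x ⊔ u)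
  orthogonalComplement U = record
    { member   = λ q → ∀ p → Subset.member U p → Orthogonal p q
    ; respects = λ q≈q′ q⊥U p p∈U →
        trans (d-cong space (Setoid.refl setoid) (Setoid.sym setoid q≈q′))
          (trans (q⊥U p p∈U) (∨-cong refl (d-cong space q≈q′ (Setoid.refl setoid))))
    }

{-# OPTIONS --safe #-}
-- In a convex space any two points p, q are exchanged by an isometry fixing every point
-- equidistant from p and q.  Composing such swaps, an isometry f between subspaces is extended
-- from one generator to the next: if F agrees with f on some generators and s is a new one, the
-- swap of F s and f s fixes f t for each earlier t, since d (f t) (F s) = d t s = d (f t) (f s).
-- As isometries preserve convex combinations, the resulting isometry of X agrees with f on all
-- of U₁.  After a swap inside U₂ one may assume f 0 = 0, and then F maps U₁^⊥ onto U₂^⊥.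
module Submission where

open import Defs
open import Level using (Level; _⊔_)
open import Algebra.Lattice.Bundles using (BooleanAlgebra)
import Algebra.Lattice.Properties.BooleanAlgebra as BooleanAlgebraProperties
open import Data.Empty using (⊥-elim)
open import Data.Fin.Base using (zero; suc)
open import Data.List.Base using (List; []; _∷_)
open import Data.List.Relation.Unary.All as All using (All; []; _∷_)
open import Data.Nat.Base using (suc)
open import Data.Product.Base using (Σ-syntax; ∃-syntax; _×_; _,_; proj₁; proj₂)
open import Data.Vec.Functional using (Vector; foldr)
  renaming ([] to []ᵥ; _∷_ to _∷ᵥ_)
open import Function.Base using (_∘_; id)
open import Function.Bundles using (Bijection; Equivalence)
open import Function.Consequences.Setoid using (strictlySurjective⇒surjective)
import Function.Construct.Composition as Composition
open import Relation.Binary.Bundles using (Setoid; Poset)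
import Relation.Binary.Lattice.Bundles as OrderTheoretic
open import Relation.Binary.PropositionalEquality.Core as ≡ using (_≢_)

-- Order and partitions in a Boolean algebra.

module BooleanOrder {b ℓ : Level} (B : BooleanAlgebra b ℓ) where
  open BooleanAlgebra B
  open BooleanAlgebraProperties B
  open Poset poset public
    using (_≤_; antisym; ≤-respʳ-≈; ≤-respˡ-≈)
    renaming (refl to ≤-refl; reflexive to ≤-reflexive; trans to ≤-trans)
  open OrderTheoretic.Lattice ∨-∧-orderTheoreticLattice public
    using (x≤x∨y; y≤x∨y; ∨-least; x∧y≤x; x∧y≤y; ∧-greatest)

  private
    variable
      x y z u v : Carrier

  ⊥-least : ⊥ ≤ x
  ⊥-least {x} = sym (∧-zeroˡ x)

  ≤⊥⇒≈⊥ : x ≤ ⊥ → x ≈ ⊥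
  ≤⊥⇒≈⊥ x≤⊥ = antisym x≤⊥ ⊥-least

  ∨-mono : x ≤ y → u ≤ v → (x ∨ u) ≤ (y ∨ v)
  ∨-mono x≤y u≤v = ∨-least (≤-trans x≤y (x≤x∨y _ _)) (≤-trans u≤v (y≤x∨y _ _))

  ∧-mono : x ≤ y → u ≤ v → (x ∧ u) ≤ (y ∧ v)
  ∧-mono x≤y u≤v = ∧-greatest (≤-trans (x∧y≤x _ _) x≤y) (≤-trans (x∧y≤y _ _) u≤v)

  -- Case distinction in the algebra: by distributivity `x` splits into its parts under `y` and
  -- under `z`. With distances for `y`, this decides whether two points agree.
  cut : x ≤ (y ∨ z) → (x ∧ y) ≤ z → x ≤ z
  cut {x} {y} {z} x≤y∨z x∧y≤z = ≤-trans (∧-greatest ≤-refl x≤y∨z)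
    (≤-respˡ-≈ (sym (∧-distribˡ-∨ x y z)) (∨-least x∧y≤z (x∧y≤y x z)))

  ¬x∧y≈⊥⇒y≤x : (¬ x ∧ y) ≈ ⊥ → y ≤ x
  ¬x∧y≈⊥⇒y≤x {x} {y} ¬x∧y≈⊥ = cut
    (≤-respʳ-≈ (sym (∨-complementˡ x)) (sym (∧-identityʳ y)))
    (≤-trans (≤-reflexive (trans (∧-comm y (¬ x)) ¬x∧y≈⊥)) ⊥-least)

  x∧¬x≤y : (x ∧ ¬ x) ≤ y
  x∧¬x≤y {x} = ≤-trans (≤-reflexive (∧-complementʳ x)) ⊥-least

  foldr-∨-disjoint : ∀ {n} (a : Vector Carrier n) →
                     (∀ i → (a i ∧ x) ≈ ⊥) → (foldr _∨_ ⊥ a ∧ x) ≈ ⊥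
  foldr-∨-disjoint {x} {0}     a a∧x≈⊥ = ∧-zeroˡ x
  foldr-∨-disjoint {x} {suc n} a a∧x≈⊥ =
    trans (∧-distribʳ-∨ x _ _)
      (trans (∨-cong (a∧x≈⊥ zero) (foldr-∨-disjoint (a ∘ suc) (a∧x≈⊥ ∘ suc))) (∨-identityʳ ⊥))

  -- Meets distribute over the join of the pieces, which is `⊤`; so vanishing can be tested piece by
  -- piece.
  covered⇒≈⊥ : ∀ {n} {a : Vector Carrier n} → IsPartition B a →
               (∀ i → (a i ∧ x) ≈ ⊥) → x ≈ ⊥
  covered⇒≈⊥ {x} {a = a} part a∧x≈⊥ = trans (sym (∧-identityˡ x))
    (trans (∧-congʳ (sym (IsPartition.covering part))) (foldr-∨-disjoint a a∧x≈⊥))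

  -- For distances `x` and `y` from a point to two others, the pieces are where it meets the first,
  -- where it meets only the second, and where it meets neither. Ties go to the first.
  decisionPieces : Carrier → Carrier → Vector Carrier 3
  decisionPieces x y = ¬ x ∷ᵥ (x ∧ ¬ y) ∷ᵥ (x ∧ y) ∷ᵥ []ᵥ

  decisionPieces-isPartition : ∀ x y → IsPartition B (decisionPieces x y)
  decisionPieces-isPartition x y = record { disjoint = disjoint ; covering = covering }
    where
    ¬x#x∧ : ∀ z → (¬ x ∧ (x ∧ z)) ≈ ⊥
    ¬x#x∧ z = ≤⊥⇒≈⊥ (≤-trans (∧-mono ≤-refl (x∧y≤x x z)) (≤-reflexive (∧-complementˡ x)))

    x∧¬y#x∧y : ((x ∧ ¬ y) ∧ (x ∧ y)) ≈ ⊥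
    x∧¬y#x∧y = ≤⊥⇒≈⊥ (≤-trans (∧-mono (x∧y≤y _ _) (x∧y≤y _ _)) (≤-reflexive (∧-complementˡ y)))

    disjoint : ∀ i j → i ≢ j → (decisionPieces x y i ∧ decisionPieces x y j) ≈ ⊥
    disjoint zero             zero             i≢j = ⊥-elim (i≢j ≡.refl)
    disjoint zero             (suc zero)       _   = ¬x#x∧ (¬ y)
    disjoint zero             (suc (suc zero)) _   = ¬x#x∧ y
    disjoint (suc zero)       zero             _   = trans (∧-comm _ _) (¬x#x∧ (¬ y))
    disjoint (suc zero)       (suc zero)       i≢j = ⊥-elim (i≢j ≡.refl)
    disjoint (suc zero)       (suc (suc zero)) _   = x∧¬y#x∧y
    disjoint (suc (suc zero)) zero             _   = trans (∧-comm _ _) (¬x#x∧ y)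
    disjoint (suc (suc zero)) (suc zero)       _   = trans (∧-comm _ _) x∧¬y#x∧y
    disjoint (suc (suc zero)) (suc (suc zero)) i≢j = ⊥-elim (i≢j ≡.refl)

    covering : foldr _∨_ ⊥ (decisionPieces x y) ≈ ⊤
    covering = trans (∨-congˡ (trans (∨-congˡ (∨-identityʳ _))
      (trans (sym (∧-distribˡ-∨ x (¬ y) y))
        (trans (∧-congˡ (∨-complementˡ y)) (∧-identityʳ x)))))
      (∨-complementˡ x)

-- Distances and isometric maps.

module _ {b ℓ x ℓx : Level} {B : BooleanAlgebra b ℓ} (X : BooleanMetricSpace B x ℓx) where
  open BooleanAlgebra B using (_≈_; _∨_; ⊥)
  open BooleanOrder B using (_≤_; ≤-respʳ-≈)
  open BooleanMetricSpace X

  d-refl : ∀ p → d p p ≈ ⊥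
  d-refl p = Equivalence.from (d-zero p p) (Setoid.refl setoid)

  triangleˡ : ∀ p q r → d p r ≤ (d q p ∨ d q r)
  triangleˡ p q r = ≤-respʳ-≈ (BooleanAlgebra.∨-congʳ B (d-sym p q)) (triangle p q r)

module _ {b ℓ x ℓx y ℓy : Level} {B : BooleanAlgebra b ℓ}
         {X : BooleanMetricSpace B x ℓx} {Y : BooleanMetricSpace B y ℓy} where
  open BooleanAlgebra B
    using (_≈_; sym; trans; ∧-congˡ; ∧-distribˡ-∨) renaming (Carrier to ∣B∣)
  open BooleanOrder B
  private
    module X = BooleanMetricSpace X
    module Y = BooleanMetricSpace Y
    module Yₛ = Setoid Y.setoid

  IsIsometric : (X.Carrier → Y.Carrier) → Set (ℓ ⊔ x)
  IsIsometric f = ∀ p q → Y.d (f p) (f q) ≈ X.d p q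

  isometric⇒cong : ∀ {f} → IsIsometric f → ∀ {p q} → p X.≈ₚ q → f p Y.≈ₚ f q
  isometric⇒cong iso p≈q = Equivalence.to (Y.d-zero _ _)
    (trans (iso _ _) (Equivalence.from (X.d-zero _ _) p≈q))

  isometric⇒injective : ∀ {f} → IsIsometric f → ∀ {p q} → f p Y.≈ₚ f q → p X.≈ₚ q
  isometric⇒injective iso fp≈fq = Equivalence.to (X.d-zero _ _)
    (trans (sym (iso _ _)) (Equivalence.from (Y.d-zero _ _) fp≈fq))

  isometry : (f : X.Carrier → Y.Carrier) → IsIsometric f →
             (∀ q → ∃[ p ] f p Y.≈ₚ q) → Isometry X Y
  isometry f iso onto = record
    { bijection = record
      { to        = f
      ; cong      = isometric⇒cong iso
      ; bijective = isometric⇒injective iso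
                  , strictlySurjective⇒surjective X.setoid Y.setoid (isometric⇒cong iso) onto
      }
    ; preserves-d = iso
    }

  isometric-combination : ∀ {f} → IsIsometric f →
    ∀ {n} {a : Vector ∣B∣ n} {xs p} →
    IsConvexCombination X a xs p → IsConvexCombination Y a (f ∘ xs) (f p)
  isometric-combination iso comb = record
    { isPartition = isPartition
    ; agrees      = λ i → trans (∧-congˡ (iso _ _)) (agrees i)
    }
    where open IsConvexCombination comb

  -- On the piece `a i` both `p` and `q` agree with the `i`-th point, so `d p q` is disjoint from
  -- every piece of a cover.
  combination-unique : ∀ {n} {a : Vector ∣B∣ n} {ys zs p q} →
    (∀ i → ys i Y.≈ₚ zs i) →
    IsConvexCombination Y a ys p → IsConvexCombination Y a zs q → p Y.≈ₚ q
  combination-unique {a = a} {ys} {zs} {p} {q} ys≈zs combp combq =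
    Equivalence.to (Y.d-zero p q) (covered⇒≈⊥ P.isPartition λ i → ≤⊥⇒≈⊥
      (≤-trans (∧-mono ≤-refl (Y.triangle p (ys i) q))
        (≤-trans (≤-reflexive (∧-distribˡ-∨ _ _ _))
          (∨-least (≤-reflexive (P.agrees i))
            (≤-reflexive (trans
              (∧-congˡ (trans (Y.d-sym _ _) (d-cong Y Yₛ.refl (ys≈zs i))))
              (Q.agrees i)))))))
    where
    module P = IsConvexCombination combp
    module Q = IsConvexCombination combq

  isometric-determined : ∀ {f g} → IsIsometric f → IsIsometric g →
    ((S , _) : IsFinitelyGenerated X) → All (λ s → f s Y.≈ₚ g s) S → ∀ p → f p Y.≈ₚ g p
  isometric-determined {f} {g} f-iso g-iso (S , generates) f≈g p =
    let _ , _ , _ , xs∈S , comb = generates p in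
    combination-unique
      -- Membership in `S` is up to `≈ₚ`, so agreement of `f` and `g` must be carried from a listed
      -- point to an equal one.
      (λ i → All.lookupₛ X.setoid
        (λ r≈s fr≈gr → Yₛ.trans (isometric⇒cong f-iso (Setoid.sym X.setoid r≈s))
          (Yₛ.trans fr≈gr (isometric⇒cong g-iso r≈s)))
        f≈g (xs∈S i))
      (isometric-combination f-iso comb)
      (isometric-combination g-iso comb)

_∘ᵢ_ : ∀ {b ℓ x ℓx y ℓy z ℓz} {B : BooleanAlgebra b ℓ} {X : BooleanMetricSpace B x ℓx}
       {Y : BooleanMetricSpace B y ℓy} {Z : BooleanMetricSpace B z ℓz} →
       Isometry Y Z → Isometry X Y → Isometry X Z
_∘ᵢ_ {B = B} g f = record
  { bijection   = Composition.bijection F.bijection G.bijection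
  ; preserves-d = λ p q → BooleanAlgebra.trans B (G.preserves-d _ _) (F.preserves-d p q)
  }
  where
  module F = Isometry f
  module G = Isometry g

-- The swap of two points.

module Swap {b ℓ x ℓx : Level} {B : BooleanAlgebra b ℓ} (X : BooleanMetricSpace B x ℓx) where
  open BooleanAlgebra B using (_≈_; _∨_; _∧_; ⊥; sym; trans; ∧-comm; ∧-congʳ)
  open BooleanOrder B
  open BooleanMetricSpace X

  -- With ¬ d r s as the truth value of r = s: t is q where r = p, t is p where r = q,
  -- and t is r elsewhere.
  record Swapped (p q r t : Carrier) : Set ℓ where
    field
      p↦q   : d t q ≤ d r p
      q↦p   : d t p ≤ d r q
      fixed : ((d r p ∧ d r q) ∧ d t r) ≤ ⊥

  open Swapped

  private
    variable
      p q r r′ t t′ : Carrier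

  Swapped-flip : Swapped p q r t → Swapped q p r t
  Swapped-flip σ = record
    { p↦q = q↦p σ ; q↦p = p↦q σ ; fixed = ≤-respˡ-≈ (∧-congʳ (∧-comm _ _)) (fixed σ) }

  -- Where `t` is `q`, `r` must be `p`: if `r` is `q`, then `t` is also `p`, so all four coincide;
  -- if `r` is neither, it equals `t`, which is `q`, a contradiction.
  p↤q : Swapped p q r t → d r p ≤ d t q
  p↤q {p} {q} {r} {t} σ = cut
    (≤-trans (triangle r q p) (∨-least (x≤x∨y _ _) (≤-trans (triangleˡ X q t p)
      (∨-least (y≤x∨y _ _) (≤-trans (q↦p σ) (x≤x∨y _ _))))))
    (cut (≤-trans (x∧y≤y _ _) (triangleˡ X r t q)) (≤-trans (fixed σ) ⊥-least))

  -- A swap is its own inverse. This gives surjectivity, and turns nonexpansiveness into equality of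
  -- distances.
  Swapped-sym : Swapped p q r t → Swapped p q t r
  Swapped-sym σ = record
    { p↦q   = p↤q (Swapped-flip σ)
    ; q↦p   = p↤q σ
    ; fixed = ≤-trans
        (∧-mono (∧-greatest (≤-trans (x∧y≤y _ _) (p↦q σ)) (≤-trans (x∧y≤x _ _) (q↦p σ)))
                (≤-reflexive (d-sym _ _)))
        (fixed σ)
    }

  -- Where `r` is `p` and `r′` is `r`, both images are `q`.
  Swapped-bound : Swapped p q r t → Swapped p q r′ t′ → d t t′ ≤ (d r p ∨ d r r′)
  Swapped-bound {p} {q} {r} {t} {r′} {t′} σ σ′ = ≤-trans (triangle t q t′) (∨-least
    (≤-trans (p↦q σ) (x≤x∨y _ _))
    (≤-trans (≤-reflexive (d-sym q t′)) (≤-trans (p↦q σ′) (≤-trans (triangleˡ X r′ r p)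
      (∨-least (y≤x∨y _ _) (x≤x∨y _ _))))))

  -- Where `t` differs from `r`, `r` is `p` or `q`, and `Swapped-bound` applies directly or with `p`
  -- and `q` flipped.
  Swapped-moved : Swapped p q r t → Swapped p q r′ t′ → (d t t′ ∧ d t r) ≤ d r r′
  Swapped-moved σ σ′ = cut
    (≤-trans (x∧y≤x _ _) (Swapped-bound σ σ′))
    (cut (≤-trans (x∧y≤x _ _) (≤-trans (x∧y≤x _ _)
           (Swapped-bound (Swapped-flip σ) (Swapped-flip σ′))))
      (≤-trans
        (∧-greatest (∧-mono (x∧y≤y _ _) ≤-refl)
                    (≤-trans (x∧y≤x _ _) (≤-trans (x∧y≤x _ _) (x∧y≤y _ _))))
        (≤-trans (fixed σ) ⊥-least)))

  -- Where one of `r`, `r′` is moved, `Swapped-moved` applies to it; where both stay, the triangle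
  -- inequality suffices.
  Swapped-nonexpansive : Swapped p q r t → Swapped p q r′ t′ → d t t′ ≤ d r r′
  Swapped-nonexpansive {r = r} {t} {r′} {t′} σ σ′ = cut
    (cut (≤-trans (triangle t r t′) (∨-mono ≤-refl
           (≤-trans (triangle r r′ t′)
             (∨-least (y≤x∨y _ _) (≤-trans (≤-reflexive (d-sym r′ t′)) (x≤x∨y _ _))))))
      (≤-trans (Swapped-moved σ σ′) (y≤x∨y _ _)))
    (≤-trans (∧-mono (≤-reflexive (d-sym t t′)) ≤-refl)
      (≤-trans (Swapped-moved σ′ σ) (≤-reflexive (d-sym r′ r))))

  Swapped-isometric : Swapped p q r t → Swapped p q r′ t′ → d t t′ ≈ d r r′
  Swapped-isometric σ σ′ = antisym (Swapped-nonexpansive σ σ′)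
    (Swapped-nonexpansive (Swapped-sym σ) (Swapped-sym σ′))

  Swapped-exchange : Swapped p q p q
  Swapped-exchange {p} {q} = record
    { p↦q   = ≤-trans (≤-reflexive (d-refl X q)) ⊥-least
    ; q↦p   = ≤-reflexive (d-sym q p)
    ; fixed = ≤-trans (x∧y≤x _ _) (≤-trans (x∧y≤x _ _) (≤-reflexive (d-refl X p)))
    }

  -- Here `r` meets `p` exactly where it meets `q`, so wherever the swap would act on `r`, the two
  -- exchanged points coincide.
  Swapped-equidistant : d r p ≈ d r q → Swapped p q r r
  Swapped-equidistant rp≈rq = record
    { p↦q   = ≤-reflexive (sym rp≈rq)
    ; q↦p   = ≤-reflexive rp≈rq
    ; fixed = ≤-trans (x∧y≤y _ _) (≤-reflexive (d-refl X _))
    }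

  module _ (convex : IsConvex X) (p q : Carrier) where

    Swapped-total : ∀ r → ∃[ t ] Swapped p q r t
    Swapped-total r =
      -- The values on the three pieces: `q` where `r` is `p`, `p` where `r` is only `q`, and `r`
      -- elsewhere.
      let t , comb = convex (decisionPieces (d r p) (d r q)) (q ∷ᵥ p ∷ᵥ r ∷ᵥ []ᵥ)
                            (decisionPieces-isPartition _ _)
          open IsConvexCombination comb
          t-q≤r-p = ¬x∧y≈⊥⇒y≤x (agrees zero)
      in t , record
        { p↦q   = t-q≤r-p
        -- The second piece covers only the region where `r` is not `p`. Where `r` is both `p` and
        -- `q`, the first piece gives `q`, which equals `p` there.
        ; q↦p   = cut
            (≤-trans (triangle t q p) (∨-least
              (≤-trans t-q≤r-p (x≤x∨y _ _))
              (≤-trans (triangleˡ X q r p) (∨-least (y≤x∨y _ _) (x≤x∨y _ _)))))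
            (¬x∧y≈⊥⇒y≤x (≤⊥⇒≈⊥ (≤-trans
              (∧-greatest (∧-greatest (≤-trans (x∧y≤y _ _) (x∧y≤y _ _)) (x∧y≤x _ _))
                          (≤-trans (x∧y≤y _ _) (x∧y≤x _ _)))
              (≤-reflexive (agrees (suc zero))))))
        ; fixed = ≤-reflexive (agrees (suc (suc zero)))
        }

    swapPoint : Carrier → Carrier
    swapPoint r = proj₁ (Swapped-total r)

    -- Preservation of distances for two images of the same `r` makes their distance `⊥`.
    swapPoint-unique : Swapped p q r t → swapPoint r ≈ₚ t
    swapPoint-unique {r} σ = Equivalence.to (d-zero _ _)
      (trans (Swapped-isometric (proj₂ (Swapped-total r)) σ) (d-refl X r))

    swap : Isometry X X
    swap = isometry swapPoint
      (λ r r′ → Swapped-isometric (proj₂ (Swapped-total r)) (proj₂ (Swapped-total r′)))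
      (λ r → swapPoint r , swapPoint-unique (Swapped-sym (proj₂ (Swapped-total r))))

    swap-exchanges : swapPoint p ≈ₚ q
    swap-exchanges = swapPoint-unique Swapped-exchange

    swap-fixes : d r p ≈ d r q → swapPoint r ≈ₚ r
    swap-fixes = swapPoint-unique ∘ Swapped-equidistant

-- Extension of isometries along a list of points.

module _ {b ℓ x ℓx : Level} {B : BooleanAlgebra b ℓ} (X : BooleanMetricSpace B x ℓx)
         (convex : IsConvex X) where
  open BooleanAlgebra B using (_≈_; sym; trans)
  open BooleanMetricSpace X
  open Swap X
  private
    module ≈ₚ = Setoid setoid

  -- Two indexed families, rather than a map on a subset, let points paired with membership proofs
  -- serve as indices.
  extend : ∀ {i} {I : Set i} (e f : I → Carrier) →
           (∀ i j → d (f i) (f j) ≈ d (e i) (e j)) → (S : List I) →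
           Σ[ F ∈ Isometry X X ] All (λ i → Isometry.to F (e i) ≈ₚ f i) S
  extend e f iso []      = isometry id (λ _ _ → BooleanAlgebra.refl B) (λ p → p , ≈ₚ.refl) , []
  extend e f iso (s ∷ S) =
    let F , F≈f = extend e f iso S
        module F = Isometry F
        σ = swap convex (F.to (e s)) (f s)
    in σ ∘ᵢ F
     , swap-exchanges convex _ _
     ∷ All.map
         (λ {i} Fi≈fi → ≈ₚ.trans
           (isometric⇒cong {X = X} {Y = X} (Isometry.preserves-d σ) Fi≈fi)
           (swap-fixes convex _ _
             (trans (d-cong X (≈ₚ.sym Fi≈fi) ≈ₚ.refl)
               (trans (F.preserves-d (e i) (e s)) (sym (iso i s))))))
         F≈f

-- Transport of orthogonal complements.

module _ {b ℓ x ℓx u₁ u₂ : Level} {B : BooleanAlgebra b ℓ} (X : PointedSpace B x ℓx) where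
  open BooleanAlgebra B using (_≈_; sym; trans; ∨-cong)
  open PointedSpace X

  -- Fixing `0ₚ` preserves norms, so `F` preserves and reflects orthogonality. `onto` shows that
  -- images of points of the first complement lie in the second; `into` shows that preimages of
  -- points of the second lie in the first.
  complement-isometry :
    (U₁ : Subset space u₁) (U₂ : Subset space u₂) (F : Isometry space space) →
    let open Isometry F in
    to 0ₚ ≈ₚ 0ₚ →
    (∀ {p} → Subset.member U₁ p → Subset.member U₂ (to p)) →
    (∀ {q} → Subset.member U₂ q → ∃[ p ] Subset.member U₁ p × to p ≈ₚ q) →
    Isometry (subspace space (orthogonalComplement X U₁))
             (subspace space (orthogonalComplement X U₂))
  complement-isometry U₁ U₂ F F0≈0 into onto = isometry
    (λ (y , y⊥U₁) → F.to y , λ q q∈U₂ →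
      let p , p∈U₁ , Fp≈q = onto q∈U₂ in
      trans (d-cong space (≈ₚ.sym Fp≈q) ≈ₚ.refl)
        (trans (orthogonal-preserved (y⊥U₁ p p∈U₁))
          (∨-cong (d-cong space Fp≈q ≈ₚ.refl) (BooleanAlgebra.refl B))))
    (λ (y , _) (z , _) → F.preserves-d y z)
    (λ (z , z⊥U₂) →
      let y , Fy≈z = F.strictlySurjective z in
      (y , λ p p∈U₁ → orthogonal-reflected (Subset.respects (orthogonalComplement X U₂)
        (≈ₚ.sym Fy≈z) z⊥U₂ (F.to p) (into p∈U₁))) , Fy≈z)
    where
    module ≈ₚ = Setoid setoid
    module F where
      open Isometry F public
      open Bijection bijection public using (strictlySurjective)

    norm-preserved : ∀ p → norm X (F.to p) ≈ norm X p
    norm-preserved p = trans (d-cong space ≈ₚ.refl (≈ₚ.sym F0≈0)) (F.preserves-d p 0ₚ)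

    orthogonal-preserved : ∀ {p q} → Orthogonal X p q → Orthogonal X (F.to p) (F.to q)
    orthogonal-preserved p⊥q = trans (F.preserves-d _ _)
      (trans p⊥q (sym (∨-cong (norm-preserved _) (norm-preserved _))))

    orthogonal-reflected : ∀ {p q} → Orthogonal X (F.to p) (F.to q) → Orthogonal X p q
    orthogonal-reflected Fp⊥Fq = trans (sym (F.preserves-d _ _))
      (trans Fp⊥Fq (∨-cong (norm-preserved _) (norm-preserved _)))

theorem3p1 : {b ℓ x ℓx u₁ u₂ : Level} (B : BooleanAlgebra b ℓ) (X : PointedSpace B x ℓx) →
    let open PointedSpace X in
    IsCFG space →
    (U₁ : Subset space u₁) (U₂ : Subset space u₂) →
    IsCFG (subspace space U₁) →
    IsCFG (subspace space U₂) →
    Subset.member U₁ 0ₚ →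
    Subset.member U₂ 0ₚ →
    Isometry (subspace space U₁) (subspace space U₂) →
    Isometry (subspace space (orthogonalComplement X U₁))
    (subspace space (orthogonalComplement X U₂))
theorem3p1 B X cfg U₁ U₂ cfg₁ cfg₂ 0∈U₁ 0∈U₂ f =
  complement-isometry X U₁ U₂ F
    (≈ₚ.trans (F≈g (0ₚ , 0∈U₁)) (swap-exchanges (IsCFG.convex cfg₂) _ _))
    (λ {p} p∈U₁ → Subset.respects U₂ (≈ₚ.sym (F≈g (p , p∈U₁))) (proj₂ (g.to (p , p∈U₁))))
    (λ {q} q∈U₂ →
      let (p , p∈U₁) , gp≈q = Bijection.strictlySurjective g.bijection (q , q∈U₂) in
      p , p∈U₁ , ≈ₚ.trans (F≈g (p , p∈U₁)) gp≈q)
  where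
  open PointedSpace X
  open Swap (subspace space U₂) using (swap; swap-exchanges)
  module ≈ₚ = Setoid setoid

  g : Isometry (subspace space U₁) (subspace space U₂)
  -- Swapping within `U₂` rather than in the whole space keeps `U₂` as the image while sending the
  -- image of `0ₚ` back to `0ₚ`.
  g = swap (IsCFG.convex cfg₂) (Isometry.to f (0ₚ , 0∈U₁)) (0ₚ , 0∈U₂) ∘ᵢ f

  module g = Isometry g

  generators = IsCFG.finitelyGenerated cfg₁

  extension = extend space (IsCFG.convex cfg) proj₁ (proj₁ ∘ g.to) g.preserves-d (proj₁ generators)

  F : Isometry space space
  F = proj₁ extension

  F≈g : ∀ u → Isometry.to F (proj₁ u) ≈ₚ proj₁ (g.to u)
  -- Both maps are read as isometric maps from `U₁` into the whole space, since distances in a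
  -- subspace are restricted ones.
  F≈g = isometric-determined {X = subspace space U₁} {Y = space}
    (λ u v → Isometry.preserves-d F (proj₁ u) (proj₁ v)) g.preserves-d
    generators (proj₂ extension)
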